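{- Let $\mathbf{CFin}$ be the category of countable finiteness spaces and finitary relations. The assignment $G$ sending a countable finiteness space $A$ to the $\mathbf{Fin}$-module $GA$ and a finitary relation $f:A\to B$ to $Gf:GA\to GB$, $(Gf)(x)=\{b\in|B|\mid\exists a\in x.\,(a,b)\in f\}$, is a fully faithful functor $\mathbf{CFin}\to\mathbf{Mod}_{\mathbf{Fin}}$.
   Context: For a set $X$ and $\mathcal{F}\subseteq\mathcal{P}(X)$, $\mathcal{F}^\perp=\{u\subseteq X\mid\forall x\in\mathcal{F}.\ x\cap u\text{ finite}\}$. A finiteness space is a pair $A=(|A|,\mathcal{F}(A))$ with $\mathcal{F}(A)\subseteq\mathcal{P}(|A|)$ and $\mathcal{F}(A)^{\perp\perp}=\mathcal{F}(A)$; countable if $|A|$ is countable. A finitary relation $f:A\to B$ is $f\subseteq|A|\times|B|$ such that for all $x\in\mathcal{F}(A)$, $\{b\mid\exists a\in x.(a,b)\in f\}\in\mathcal{F}(B)$, and for all $v\in\mathcal{F}(B)^\perp$, $\{a\mid\exists b\in v.(a,b)\in f\}\in\mathcal{F}(A)^\perp$; composition is relational. A $\Sigma$-monoid is a set with $0$ and a partial countable sum satisfying the unit law, invariance under reindexing and removal/insertion of zeros, and infinite associativity; a $\Sigma$-semiring adds a total commutative associative unital multiplication distributing over sums; an $R$-module is a $\Sigma$-monoid with a total action satisfying $(rr')x=r(r'x)$, $1x=x$, $0x=r0=0$ and distributivity; an $R$-linear map preserves $0$, the action, and sums (if $\sum x_i$ is defined then $\sum f(x_i)$ is defined and equals $f(\sum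 x_i)$). $\mathbf{Mod}_R$: category of $R$-modules. $\mathbf{Fin}$ is the $\Sigma$-semiring on $\{0,1\}$ in which a countable family has a sum iff only finitely many entries are $1$, the sum being $1$ if some entry is $1$ and $0$ otherwise, with the usual multiplication. $GA$ has carrier $\mathcal{F}(A)$; $\sum_ix_i$ is defined iff every $a\in|A|$ lies in only finitely many $x_i$ and $\bigcup_ix_i\in\mathcal{F}(A)$, in which case it equals $\bigcup_ix_i$; action $1\cdot x=x$, $0\cdot x=\emptyset$. -}

module Defs where

open import Level using (Level; 0ℓ) renaming (suc to lsuc)
open import Data.Nat using (ℕ)
open import Data.Bool using (Bool; true; false; _∧_)
open import Data.Unit using (⊤)
open import Data.Empty using (⊥)
open import Data.List using (List; [])
open import Data.List.Membership.Propositional using (_∈_)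
open import Data.Product using (Σ; ∃; _×_; _,_; proj₁; proj₂)
open import Relation.Binary.PropositionalEquality using (_≡_; _≢_)
open import Relation.Binary.Structures using (IsEquivalence)
open import Function.Bundles using (_↔_; Inverse)

Countable : Set → Set
Countable I = Σ (I → ℕ) λ ι → ∀ {i j} → ι i ≡ ι j → i ≡ j

Subset : Set → Set₁
Subset X = X → Set

∅ : {X : Set} → Subset X
∅ _ = ⊥

_∩_ : {X : Set} → Subset X → Subset X → Subset X
(x ∩ u) a = x a × u a

_≐_ : {X : Set} → Subset X → Subset X → Set
x ≐ y = ∀ a → (x a → y a) × (y a → x a)

Finite : {X : Set} → Subset X → Set
Finite {X} S = Σ (List X) λ l → ∀ a → S a → a ∈ l

Fam : Set → Set₂
Fam X = Subset X → Set₁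

_^⊥ : {X : Set} → Fam X → Fam X
(F ^⊥) u = ∀ x → F x → Finite (x ∩ u)

record CFinSpace : Set₂ where
  field
    web       : Set
    countable : Countable web
    fin       : Fam web
    closed    : ∀ x → (((fin ^⊥) ^⊥) x → fin x) × (fin x → ((fin ^⊥) ^⊥) x)

open CFinSpace public

Rel : Set → Set → Set₁
Rel X Y = X → Y → Set

_≐R_ : {X Y : Set} → Rel X Y → Rel X Y → Set
f ≐R g = ∀ a b → (f a b → g a b) × (g a b → f a b)

img : {X Y : Set} → Rel X Y → Subset X → Subset Y
img f x b = ∃ λ a → x a × f a b

preimg : {X Y : Set} → Rel X Y → Subset Y → Subset X
preimg f v a = ∃ λ b → v b × f a b

IsFinitary : (A B : CFinSpace) → Rel (web A) (web B) → Set₁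
IsFinitary A B f =
  (∀ x → fin A x → fin B (img f x)) ×
  (∀ v → (fin B ^⊥) v → (fin A ^⊥) (preimg f v))

idRel : {X : Set} → Rel X X
idRel a b = a ≡ b

_∘R_ : {X Y Z : Set} → Rel Y Z → Rel X Y → Rel X Z
(g ∘R f) a c = ∃ λ b → f a b × g b c

-- The Σ-semiring Fin on {0,1} = Bool (multiplication _∧_):
-- a family r has a sum iff only finitely many entries are 1; the sum is 1
-- iff some entry is 1.

FinHasSum : {I : Set} → (I → Bool) → Bool → Set
FinHasSum r s = Finite (λ i → r i ≡ true) × ((s ≡ true → ∃ λ i → r i ≡ true) × ((∃ λ i → r i ≡ true) → s ≡ true))

-- Fin-modules (Σ-monoids with a Fin-action), in setoid style.
-- HasSum x s  means  "Σ_i x_i is defined and equals s".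

record FinModuleStr : Set₂ where
  field
    Carrier : Set₁
    _≈_     : Carrier → Carrier → Set
    𝟘       : Carrier
    HasSum  : {I : Set} → (I → Carrier) → Carrier → Set₁
    act     : Bool → Carrier → Carrier

Fibre : {I J : Set} → (I → J) → J → Set
Fibre {I} p j = Σ I λ i → p i ≡ j

record IsFinModule (M : FinModuleStr) : Set₂ where
  open FinModuleStr M
  field
    ≈-equiv    : IsEquivalence _≈_
    sum-unique : ∀ {I} → Countable I → (x : I → Carrier) → ∀ {s s'} →
                 HasSum x s → HasSum x s' → s ≈ s'
    sum-resp   : ∀ {I} → Countable I → (x y : I → Carrier) → ∀ {s t} →
                 (∀ i → x i ≈ y i) → s ≈ t → HasSum x s → HasSum y t
    sum-unit   : ∀ a → HasSum {⊤} (λ _ → a) a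
    sum-reindex : ∀ {I J} → Countable I → Countable J → (σ : J ↔ I) →
                  (x : I → Carrier) → ∀ s →
                  (HasSum x s → HasSum (λ j → x (Inverse.to σ j)) s) ×
                  (HasSum (λ j → x (Inverse.to σ j)) s → HasSum x s)
    sum-zeros  : ∀ {I J} → Countable I → Countable J → (e : J → I) →
                 (∀ {j j'} → e j ≡ e j' → j ≡ j') →
                 (x : I → Carrier) → (∀ i → (∀ j → e j ≢ i) → x i ≈ 𝟘) → ∀ s →
                 (HasSum x s → HasSum (λ j → x (e j)) s) ×
                 (HasSum (λ j → x (e j)) s → HasSum x s)
    sum-assoc  : ∀ {I J} → Countable I → Countable J → (p : I → J) →
                 (x : I → Carrier) → ∀ s → HasSum x s →
                 Σ (J → Carrier) λ t →
                   (∀ j → HasSum (λ (k : Fibre p j) → x (proj₁ k)) (t j)) × HasSum t s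
    act-resp   : ∀ r {a b} → a ≈ b → act r a ≈ act r b
    act-assoc  : ∀ r r' a → act (r ∧ r') a ≈ act r (act r' a)
    act-one    : ∀ a → act true a ≈ a
    act-zeroˡ  : ∀ a → act false a ≈ 𝟘
    act-zeroʳ  : ∀ r → act r 𝟘 ≈ 𝟘
    act-distˡ  : ∀ {I} → Countable I → (r : Bool) → (x : I → Carrier) → ∀ s →
                 HasSum x s → HasSum (λ i → act r (x i)) (act r s)
    act-distʳ  : ∀ {I} → Countable I → (r : I → Bool) → (a : Carrier) → ∀ s →
                 FinHasSum r s → HasSum (λ i → act (r i) a) (act s a)

record IsLinear (M N : FinModuleStr) (h : FinModuleStr.Carrier M → FinModuleStr.Carrier N) : Set₂ where
  module M = FinModuleStr M
  module N = FinModuleStr N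
  field
    resp  : ∀ {a b} → a M.≈ b → h a N.≈ h b
    zero  : h M.𝟘 N.≈ N.𝟘
    act   : ∀ r a → h (M.act r a) N.≈ N.act r (h a)
    sums  : ∀ {I} → Countable I → (x : I → M.Carrier) → ∀ s →
            M.HasSum x s → N.HasSum (λ i → h (x i)) (h s)

-- helper: ∅ ∈ F(A) (since ∅ ∈ F(A)^⊥⊥)
∅-fin : (A : CFinSpace) → fin A ∅
∅-fin A = proj₁ (closed A ∅) (λ u _ → [] , λ a p → Data.Empty.⊥-elim (proj₂ p))
  where import Data.Empty

⋃ : {X I : Set} → (I → Subset X) → Subset X
⋃ x a = ∃ λ i → x i a

GCarrier : CFinSpace → Set₁
GCarrier A = Σ (Subset (web A)) (fin A)

G : CFinSpace → FinModuleStr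
G A = record
  { Carrier = GCarrier A
  ; _≈_     = λ x y → proj₁ x ≐ proj₁ y
  ; 𝟘       = ∅ , ∅-fin A
  ; HasSum  = λ {I} x s →
      (∀ a → Finite (λ i → proj₁ (x i) a)) ×
      (fin A (⋃ (λ i → proj₁ (x i))) ×
       (proj₁ s ≐ ⋃ (λ i → proj₁ (x i))))
  ; act     = λ { true x → x ; false x → ∅ , ∅-fin A }
  }

Gmap : (A B : CFinSpace) (f : Rel (web A) (web B)) → IsFinitary A B f →
       GCarrier A → GCarrier B
Gmap A B f hf (x , px) = img f x , proj₁ hf x px

-- An element x of GA is the sum of the family ({a} ∩ x)ₐ indexed by the countable web of A,
-- so a linear h : GA → GB is determined by its values h {a}; the relation f a b := b ∈ h {a}
-- satisfies Gf = h and is finitary because h preserves that sum. Faithfulness is the same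
-- observation applied to Gf itself: (Gf) {a} is the row of f at a. Excluded middle is needed to
-- decide whether a lies in x, and in the module axioms to locate the preimages of an index.
module Submission where

open import Defs
open import Level using (Level; 0ℓ)
open import Data.Product using (Σ; _×_; proj₁; proj₂; _,_; ∃)
open import Axiom.ExcludedMiddle using (ExcludedMiddle)
open import Data.Bool using (Bool; true; false)
open import Data.Empty using (⊥-elim)
open import Data.Unit using (⊤; tt)
open import Data.List using (List; []; _∷_; _++_)
open import Data.List.Membership.Propositional using (_∈_)
open import Data.List.Membership.Propositional.Properties using (∈-++⁺ˡ; ∈-++⁺ʳ)
open import Data.List.Relation.Unary.Any using (here; there)
open import Function using (_∘_)
open import Function.Bundles using (_↔_; Inverse; Injection)
open import Function.Properties.Inverse using (Inverse⇒Injection)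
open import Relation.Binary.PropositionalEquality using (_≡_; _≢_; refl; sym)
open import Relation.Nullary using (yes; no; ¬_)
open import Relation.Unary using (_⊆′_)

≐-refl : {X : Set} {x : Subset X} → x ≐ x
≐-refl a = (λ p → p) , (λ p → p)

≐-sym : {X : Set} {x y : Subset X} → x ≐ y → y ≐ x
≐-sym x≐y a = proj₂ (x≐y a) , proj₁ (x≐y a)

≐-trans : {X : Set} {x y z : Subset X} → x ≐ y → y ≐ z → x ≐ z
≐-trans x≐y y≐z a = proj₁ (y≐z a) ∘ proj₁ (x≐y a) , proj₂ (x≐y a) ∘ proj₂ (y≐z a)

⋃-resp : {X I : Set} {x y : I → Subset X} → (∀ i → x i ≐ y i) → ⋃ x ≐ ⋃ y
⋃-resp x≐y a = (λ { (i , p) → i , proj₁ (x≐y i a) p }) , (λ { (i , p) → i , proj₂ (x≐y i a) p })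

finite-⊆ : {X : Set} {S T : Subset X} → T ⊆′ S → Finite S → Finite T
finite-⊆ T⊆S (l , S⊆l) = l , λ a t → S⊆l a (T⊆S a t)

finite-singleton : {X : Set} (a : X) → Finite (a ≡_)
finite-singleton a = a ∷ [] , λ { _ refl → here refl }

finite-img-list : {X Y : Set} {f : Rel X Y} (l : List X) → (∀ a → Finite (f a)) →
  Finite (img f (_∈ l))
finite-img-list [] finF = [] , λ { _ (_ , () , _) }
finite-img-list {f = f} (a ∷ l) finF with finF a | finite-img-list {f = f} l finF
... | la , fa⊆la | ll , img⊆ll = la ++ ll , λ
  { b (_ , here refl , fab) → ∈-++⁺ˡ (fa⊆la b fab)
  ; b (a′ , there a′∈l , fa′b) → ∈-++⁺ʳ la (img⊆ll b (a′ , a′∈l , fa′b)) }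

finite-img : {X Y : Set} {f : Rel X Y} {x : Subset X} → Finite x → (∀ a → Finite (f a)) →
  Finite (img f x)
finite-img (l , x⊆l) finF =
  finite-⊆ (λ { b (a , xa , fab) → a , x⊆l a xa , fab }) (finite-img-list l finF)

finite-image : {X Y : Set} {S : Subset X} {T : Subset Y} (g : X → Y) →
  T ⊆′ img (λ a b → g a ≡ b) S → Finite S → Finite T
finite-image g T⊆gS finS = finite-⊆ T⊆gS (finite-img finS (finite-singleton ∘ g))

finite-preimage : {I J : Set} {P : Subset I} (g : J → I) → (∀ i → Finite (λ j → g j ≡ i)) →
  Finite P → Finite (P ∘ g)
finite-preimage g finFibre finP = finite-⊆ (λ j Pgj → g j , Pgj , refl) (finite-img finP finFibre)

fibre-proj₁-injective : {I J : Set} {p : I → J} {j : J} {k k′ : Fibre p j} →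
  proj₁ k ≡ proj₁ k′ → k ≡ k′
fibre-proj₁-injective {k = _ , refl} {_ , refl} refl = refl

module FinitenessSpace (A : CFinSpace) where

  fin-⊆ : {x y : Subset (web A)} → y ⊆′ x → fin A x → fin A y
  fin-⊆ {x} {y} y⊆x finX = proj₁ (closed A y) λ u u∈perp →
    finite-⊆ (λ { a (ua , ya) → ua , y⊆x a ya }) (proj₂ (closed A x) finX u u∈perp)

  fin-resp : {x y : Subset (web A)} → x ≐ y → fin A x → fin A y
  fin-resp x≐y = fin-⊆ (λ a → proj₂ (x≐y a))

  fin-singleton : (a : web A) → fin A (a ≡_)
  fin-singleton a = proj₁ (closed A _) λ u _ → finite-⊆ (λ _ → proj₂) (finite-singleton a)

  singleton-∈-perp : (a : web A) → (fin A ^⊥) (a ≡_)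
  singleton-∈-perp a x _ = finite-⊆ (λ _ → proj₂) (finite-singleton a)

  singleton : web A → GCarrier A
  singleton a = (a ≡_) , fin-singleton a

open FinitenessSpace

module _ {X Y : Set} where

  img-resp-≐ : (f : Rel X Y) {x y : Subset X} → x ≐ y → img f x ≐ img f y
  img-resp-≐ f x≐y b = (λ { (a , xa , fab) → a , proj₁ (x≐y a) xa , fab })
                     , (λ { (a , ya , fab) → a , proj₂ (x≐y a) ya , fab })

  img-resp-≐R : {f g : Rel X Y} → f ≐R g → (x : Subset X) → img f x ≐ img g x
  img-resp-≐R f≐g x b = (λ { (a , xa , fab) → a , xa , proj₁ (f≐g a b) fab })
                      , (λ { (a , xa , gab) → a , xa , proj₂ (f≐g a b) gab })

  img-∅ : (f : Rel X Y) → img f ∅ ≐ ∅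
  img-∅ f b = (λ { (_ , () , _) }) , λ ()

  img-⋃ : {I : Set} (f : Rel X Y) (x : I → Subset X) → img f (⋃ x) ≐ ⋃ (img f ∘ x)
  img-⋃ f x b = (λ { (a , (i , xia) , fab) → i , a , xia , fab })
              , (λ { (i , a , xia , fab) → a , (i , xia) , fab })

  img-singleton⁻ : (f : Rel X Y) {a : X} {b : Y} → img f (a ≡_) b → f a b
  img-singleton⁻ f (_ , refl , fab) = fab

  ≐R-from-img-singletons : {f g : Rel X Y} → (∀ a → img f (a ≡_) ≐ img g (a ≡_)) → f ≐R g
  ≐R-from-img-singletons {f} {g} f≐g a b =
      (λ fab → img-singleton⁻ g (proj₁ (f≐g a b) (a , refl , fab)))
    , (λ gab → img-singleton⁻ f (proj₂ (f≐g a b) (a , refl , gab)))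

img-idRel : {X : Set} (x : Subset X) → img idRel x ≐ x
img-idRel x b = (λ { (_ , xb , refl) → xb }) , (λ xb → b , xb , refl)

img-∘R : {X Y Z : Set} (f : Rel X Y) (g : Rel Y Z) (x : Subset X) →
  img (g ∘R f) x ≐ img g (img f x)
img-∘R f g x c = (λ { (a , xa , b , fab , gbc) → b , (a , xa , fab) , gbc })
               , (λ { (b , (a , xa , fab) , gbc) → a , xa , b , fab , gbc })

module _ (em : ExcludedMiddle 0ℓ) where

  finite-fibre-injective : {I J : Set} (e : J → I) → (∀ {j j′} → e j ≡ e j′ → j ≡ j′) →
    ∀ i → Finite (λ j → e j ≡ i)
  finite-fibre-injective e inj i with em {P = ∃ λ j → e j ≡ i}
  ... | yes (j , refl) = j ∷ [] , λ j′ ej′≡ej → here (inj ej′≡ej)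
  ... | no ∄j = [] , λ j ej≡i → ⊥-elim (∄j (j , ej≡i))

  module GModule (A : CFinSpace) where
    open FinModuleStr (G A)

    PointwiseFinite : {I : Set} → (I → Carrier) → Set
    PointwiseFinite x = ∀ a → Finite (λ i → proj₁ (x i) a)

    hasSum-≐⋃ : {I J : Set} (x : I → Carrier) (y : J → Carrier) (s : Carrier) →
      (PointwiseFinite x → PointwiseFinite y) → ⋃ (proj₁ ∘ x) ≐ ⋃ (proj₁ ∘ y) →
      HasSum x s → HasSum y s
    hasSum-≐⋃ _ _ _ finY x≐y (finX , fin⋃x , s≐x) =
      finY finX , fin-resp A x≐y fin⋃x , ≐-trans s≐x x≐y

    hasSum-resp-≈ : {I : Set} (x : I → Carrier) (s t : Carrier) → s ≈ t → HasSum x s → HasSum x t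
    hasSum-resp-≈ _ _ _ s≈t (finX , fin⋃x , s≐x) = finX , fin⋃x , ≐-trans (≐-sym s≈t) s≐x

    hasSum-𝟘 : {I : Set} → HasSum {I} (λ _ → 𝟘) 𝟘
    hasSum-𝟘 = (λ _ → [] , λ _ ())
             , fin-⊆ A (λ { _ (_ , ()) }) (∅-fin A)
             , (λ _ → (λ ()) , (λ { (_ , ()) }))

    act-∈⁻ : ∀ r (a : Carrier) {b} → proj₁ (act r a) b → r ≡ true × proj₁ a b
    act-∈⁻ true a ab = refl , ab

    act-∈⁺ : ∀ {r} (a : Carrier) {b} → r ≡ true → proj₁ a b → proj₁ (act r a) b
    act-∈⁺ a refl ab = ab

    sum-resp : ∀ {I} → Countable I → (x y : I → Carrier) → ∀ {s t} →
      (∀ i → x i ≈ y i) → s ≈ t → HasSum x s → HasSum y t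
    sum-resp _ x y {s} {t} x≈y s≈t Σx =
      hasSum-resp-≈ y s t s≈t (hasSum-≐⋃ x y s finY (⋃-resp x≈y) Σx)
      where
      finY : PointwiseFinite x → PointwiseFinite y
      finY finX a = finite-⊆ (λ i → proj₂ (x≈y i a)) (finX a)

    sum-zeros : ∀ {I J} → Countable I → Countable J → (e : J → I) →
      (∀ {j j′} → e j ≡ e j′ → j ≡ j′) →
      (x : I → Carrier) → (∀ i → (∀ j → e j ≢ i) → x i ≈ 𝟘) → ∀ s →
      (HasSum x s → HasSum (x ∘ e) s) × (HasSum (x ∘ e) s → HasSum x s)
    sum-zeros _ _ e inj x zeros s =
        hasSum-≐⋃ x (x ∘ e) s
          (λ finX a → finite-preimage e (finite-fibre-injective e inj) (finX a)) ⋃x≐⋃xe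
      , hasSum-≐⋃ (x ∘ e) x s
          (λ finXe a → finite-image e (λ i → support⊆range i) (finXe a)) (≐-sym ⋃x≐⋃xe)
      where
      support⊆range : ∀ i {a} → proj₁ (x i) a → ∃ λ j → proj₁ (x (e j)) a × e j ≡ i
      support⊆range i {a} xia with em {P = ∃ λ j → e j ≡ i}
      ... | yes (j , refl) = j , xia , refl
      ... | no ∄j = ⊥-elim (proj₁ (zeros i (λ j ej≡i → ∄j (j , ej≡i)) a) xia)
      ⋃x≐⋃xe : ⋃ (proj₁ ∘ x) ≐ ⋃ (proj₁ ∘ x ∘ e)
      ⋃x≐⋃xe a = (λ { (i , xia) → let (j , xeja , _) = support⊆range i xia in j , xeja })
               , (λ { (j , xeja) → e j , xeja })

    sum-reindex : ∀ {I J} → Countable I → Countable J → (σ : J ↔ I) →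
      (x : I → Carrier) → ∀ s →
      (HasSum x s → HasSum (x ∘ Inverse.to σ) s) × (HasSum (x ∘ Inverse.to σ) s → HasSum x s)
    sum-reindex cI cJ σ x = sum-zeros cI cJ (Inverse.to σ) (Injection.injective (Inverse⇒Injection σ)) x
      (λ i ∉range → ⊥-elim (∉range (Inverse.from σ i) (Inverse.strictlyInverseˡ σ i)))

    sum-assoc : ∀ {I J} → Countable I → Countable J → (p : I → J) →
      (x : I → Carrier) → ∀ s → HasSum x s →
      Σ (J → Carrier) λ t → (∀ j → HasSum (λ (k : Fibre p j) → x (proj₁ k)) (t j)) × HasSum t s
    sum-assoc _ _ p x s Σx@(_ , fin⋃x , _) = t , fibreSum , hasSum-≐⋃ x t s finT ⋃x≐⋃t Σx
      where
      t : _ → Carrier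
      t j = ⋃ (λ (k : Fibre p j) → proj₁ (x (proj₁ k)))
          , fin-⊆ A (λ { a (k , xka) → proj₁ k , xka }) fin⋃x
      fibreSum : ∀ j → HasSum (λ (k : Fibre p j) → x (proj₁ k)) (t j)
      fibreSum j = (λ a → finite-preimage proj₁ (finite-fibre-injective proj₁ fibre-proj₁-injective)
                                          (proj₁ Σx a))
                 , proj₂ (t j) , ≐-refl
      finT : PointwiseFinite x → PointwiseFinite t
      finT finX a = finite-image p (λ { j ((i , pi≡j) , xia) → i , xia , pi≡j }) (finX a)
      ⋃x≐⋃t : ⋃ (proj₁ ∘ x) ≐ ⋃ (proj₁ ∘ t)
      ⋃x≐⋃t a = (λ { (i , xia) → p i , (i , refl) , xia }) , (λ { (j , (i , _) , xia) → i , xia })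

    act-distʳ : ∀ {I} → Countable I → (r : I → Bool) → (a : Carrier) → ∀ s →
      FinHasSum r s → HasSum (λ i → act (r i) a) (act s a)
    act-distʳ _ r a s (finR , s⇒∃r , ∃r⇒s) =
        (λ b → finite-⊆ (λ i → proj₁ ∘ act-∈⁻ (r i) a) finR)
      , fin-⊆ A (λ { b (i , p) → proj₂ (act-∈⁻ (r i) a p) }) (proj₂ a)
      , λ b → (λ p → let (s≡true , ab) = act-∈⁻ s a p
                         (i , ri≡true) = s⇒∃r s≡true
                     in i , act-∈⁺ a ri≡true ab)
            , (λ { (i , p) → let (ri≡true , ab) = act-∈⁻ (r i) a p
                             in act-∈⁺ a (∃r⇒s (i , ri≡true)) ab })

    isFinModule : IsFinModule (G A)
    isFinModule = record
      { ≈-equiv     = record { refl = ≐-refl ; sym = ≐-sym ; trans = ≐-trans }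
      ; sum-unique  = λ _ _ (_ , _ , s≐x) (_ , _ , s′≐x) → ≐-trans s≐x (≐-sym s′≐x)
      ; sum-resp    = sum-resp
      ; sum-unit    = λ a → (λ _ → tt ∷ [] , λ { tt _ → here refl })
                          , fin-resp A a≐⋃ (proj₂ a) , a≐⋃
      ; sum-reindex = sum-reindex
      ; sum-zeros   = sum-zeros
      ; sum-assoc   = sum-assoc
      ; act-resp    = λ { true a≈b → a≈b ; false _ → ≐-refl }
      ; act-assoc   = λ { true _ _ → ≐-refl ; false _ _ → ≐-refl }
      ; act-one     = λ _ → ≐-refl
      ; act-zeroˡ   = λ _ → ≐-refl
      ; act-zeroʳ   = λ { true → ≐-refl ; false → ≐-refl }
      ; act-distˡ   = λ { _ true _ _ Σx → Σx ; _ false _ _ _ → hasSum-𝟘 }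
      ; act-distʳ   = act-distʳ
      }
      where
      a≐⋃ : {a : Subset (web A)} → a ≐ ⋃ {I = ⊤} (λ _ → a)
      a≐⋃ _ = (λ p → tt , p) , proj₂

Gmap-isLinear : (A B : CFinSpace) (f : Rel (web A) (web B)) (hf : IsFinitary A B f) →
  IsLinear (G A) (G B) (Gmap A B f hf)
Gmap-isLinear A B f (img-fin , preimg-perp) = record
  { resp = img-resp-≐ f
  ; zero = img-∅ f
  ; act  = λ { true _ → ≐-refl ; false _ → img-∅ f }
  ; sums = λ _ x _ (finX , fin⋃x , s≐⋃x) →
      (λ b → finite-⊆ (λ { i (a , xia , fab) → a , ((i , xia) , b , refl , fab) , xia })
                      (finite-img (preimg-perp _ (singleton-∈-perp B b) _ fin⋃x) finX))
    , fin-resp B (img-⋃ f (proj₁ ∘ x)) (img-fin _ fin⋃x)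
    , ≐-trans (img-resp-≐ f s≐⋃x) (img-⋃ f (proj₁ ∘ x))
  }

module Full (em : ExcludedMiddle 0ℓ) (A B : CFinSpace) (h : GCarrier A → GCarrier B)
            (h-linear : IsLinear (G A) (G B) h) where
  open IsLinear h-linear

  rel : Rel (web A) (web B)
  rel a b = proj₁ (h (singleton A a)) b

  restrict : GCarrier A → web A → GCarrier A
  restrict x a = (λ c → a ≡ c × proj₁ x a) , fin-⊆ A (λ _ → proj₁) (fin-singleton A a)

  restrict-∈ : ∀ x {a} → proj₁ x a → proj₁ (restrict x a) ≐ (a ≡_)
  restrict-∈ x xa c = proj₁ , (_, xa)

  restrict-∉ : ∀ x {a} → ¬ proj₁ x a → proj₁ (restrict x a) ≐ ∅
  restrict-∉ x x∌a c = x∌a ∘ proj₂ , λ ()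

  h-⋃-restrict : ∀ x → FinModuleStr.HasSum (G B) (h ∘ restrict x) (h x)
  h-⋃-restrict x = sums (countable A) (restrict x) x
    ( (λ c → finite-⊆ (λ _ → sym ∘ proj₁) (finite-singleton c))
    , fin-resp A x≐⋃ (proj₂ x) , x≐⋃ )
    where
    x≐⋃ : proj₁ x ≐ ⋃ (proj₁ ∘ restrict x)
    x≐⋃ c = (λ xc → c , refl , xc) , λ { (_ , refl , xc) → xc }

  h-restrict-⊆ : ∀ x a → proj₁ (h (restrict x a)) ⊆′ proj₁ (h x)
  h-restrict-⊆ x a b hb = proj₂ (proj₂ (proj₂ (h-⋃-restrict x)) b) (a , hb)

  rel⇒h-restrict : ∀ x {a b} → proj₁ x a → rel a b → proj₁ (h (restrict x a)) b
  rel⇒h-restrict x xa = proj₂ (resp (restrict-∈ x xa) _)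

  img-rel≐h : ∀ x → img rel (proj₁ x) ≐ proj₁ (h x)
  img-rel≐h x b = (λ { (a , xa , rab) → h-restrict-⊆ x a b (rel⇒h-restrict x xa rab) }) , h⇒img-rel
    where
    h⇒img-rel : proj₁ (h x) b → img rel (proj₁ x) b
    h⇒img-rel hxb with proj₁ (proj₂ (proj₂ (h-⋃-restrict x)) b) hxb
    ... | a , hb with em {P = proj₁ x a}
    ... | yes xa = a , xa , proj₁ (resp (restrict-∈ x xa) b) hb
    ... | no x∌a = ⊥-elim (proj₁ (zero b) (proj₁ (resp (restrict-∉ x x∌a) b) hb))

  rel-isFinitary : IsFinitary A B rel
  rel-isFinitary = (λ x finX → fin-resp B (≐-sym (img-rel≐h (x , finX))) (proj₂ (h (x , finX))))
                 , preimg-perp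
    where
    preimg-perp : ∀ v → (fin B ^⊥) v → (fin A ^⊥) (preimg rel v)
    preimg-perp v v∈perp x finX =
      finite-⊆ (λ { a (xa , b , vb , rab) → let hb = rel⇒h-restrict X xa rab
                                            in b , (h-restrict-⊆ X a b hb , vb) , hb })
               (finite-img (v∈perp _ (proj₂ (h X))) (proj₁ (h-⋃-restrict X)))
      where
      X : GCarrier A
      X = x , finX

proposition3p18 : (∀ {ℓ : Level} → ExcludedMiddle ℓ) →
    ((A : CFinSpace) → IsFinModule (G A)) ×
    ((A B : CFinSpace) (f : Rel (web A) (web B)) (hf : IsFinitary A B f) →
    IsLinear (G A) (G B) (Gmap A B f hf)) ×
    ((A B : CFinSpace) (f f' : Rel (web A) (web B))
    (hf : IsFinitary A B f) (hf' : IsFinitary A B f') → f ≐R f' →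
    ∀ x → proj₁ (Gmap A B f hf x) ≐ proj₁ (Gmap A B f' hf' x)) ×
    ((A : CFinSpace) (hid : IsFinitary A A idRel) →
    ∀ x → proj₁ (Gmap A A idRel hid x) ≐ proj₁ x) ×
    ((A B C : CFinSpace) (f : Rel (web A) (web B)) (g : Rel (web B) (web C))
    (hf : IsFinitary A B f) (hg : IsFinitary B C g) (hgf : IsFinitary A C (g ∘R f)) →
    ∀ x → proj₁ (Gmap A C (g ∘R f) hgf x) ≐ proj₁ (Gmap B C g hg (Gmap A B f hf x))) ×
    ((A B : CFinSpace) (f f' : Rel (web A) (web B))
    (hf : IsFinitary A B f) (hf' : IsFinitary A B f') →
    (∀ x → proj₁ (Gmap A B f hf x) ≐ proj₁ (Gmap A B f' hf' x)) → f ≐R f') ×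
    ((A B : CFinSpace) (h : GCarrier A → GCarrier B) → IsLinear (G A) (G B) h →
    Σ (Rel (web A) (web B)) λ f → Σ (IsFinitary A B f) λ hf →
    ∀ x → proj₁ (Gmap A B f hf x) ≐ proj₁ (h x))
proposition3p18 em =
    (λ A → GModule.isFinModule em A)
  , Gmap-isLinear
  , (λ _ _ _ _ _ _ f≐f′ x → img-resp-≐R f≐f′ (proj₁ x))
  , (λ _ _ x → img-idRel (proj₁ x))
  , (λ _ _ _ f g _ _ _ x → img-∘R f g (proj₁ x))
  , (λ A _ _ _ _ _ Gf≐Gf′ → ≐R-from-img-singletons (λ a → Gf≐Gf′ (singleton A a)))
  , (λ A B h h-linear → let open Full em A B h h-linear in rel , rel-isFinitary , img-rel≐h)
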